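{- Let $M\ge 1$ be real and let $(a_n)_{n\ge 1}$ be any sequence of elements of $[0,\infty)$. Then the weak projection of the series $\sum_n a_n$ onto $\mathbf{A}_M$ converges in $\mathbf{A}_M$; that is, the sequence $\left(h\left(\sum_{n=1}^k a_n\right)\right)_{k\ge 1}$ converges to an element of $[0,M]$.
   Context: $\mathbf{A}_M=([0,M],\oplus,\otimes,\le)$ with $a\oplus b=\min(M,a+b)$, $a\otimes b=\min(M,a\times b)$, the usual order, and the topology on $[0,M]$ induced from $\mathbb{R}$. The coprojector is $h:[0,\infty)\to[0,M]$, $h(a)=\min(M,a)$. The weak projection of a series $\sum_n a_n$ of elements of $[0,\infty)$ onto $\mathbf{A}_M$ is $h\left(\sum_{n=1}^\infty a_n\right)$, understood as $\lim_{k\to\infty}h\left(\sum_{n=1}^k a_n\right)$ (the series itself may diverge to $+\infty$). -}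

module Defs where

open import Data.Nat.Base as ℕ using (ℕ; zero; suc)
import Data.Nat.Properties as ℕ
open import Data.Product.Base using (Σ-syntax; ∃-syntax; _×_; _,_)
open import Data.Rational.Base as ℚ using (ℚ; 0ℚ; 1ℚ; ½)
import Data.Rational.Properties as ℚ
open import Data.Rational.Solver using (module +-*-Solver)
open import Data.Sum.Base using (inj₁; inj₂)
open import Function.Bundles using (_⇔_)
open import Level using (0ℓ)
open import Relation.Binary.PropositionalEquality
  using (_≡_; refl; sym; trans; cong; subst; subst₂)
open import Relation.Unary using (Pred)

open +-*-Solver using (solve; _:+_; _:*_; :-_; _:-_; _:=_)

module Rational where
  p≤∣p∣ : ∀ p → p ℚ.≤ ℚ.∣ p ∣
  p≤∣p∣ p with ℚ.≤-total 0ℚ p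
  ... | inj₁ 0≤p = ℚ.≤-reflexive (sym (ℚ.0≤p⇒∣p∣≡p 0≤p))
  ... | inj₂ p≤0 = ℚ.≤-trans p≤0 (ℚ.0≤∣p∣ p)

  ∣p∣<q : ∀ {p q} → p ℚ.< q → ℚ.- p ℚ.< q → ℚ.∣ p ∣ ℚ.< q
  ∣p∣<q {p} {q} p<q -p<q with ℚ.∣p∣≡p∨∣p∣≡-p p
  ... | inj₁ eq = subst (ℚ._< q) (sym eq) p<q
  ... | inj₂ eq = subst (ℚ._< q) (sym eq) -p<q

  ∣p-q∣≡∣q-p∣ : ∀ p q → ℚ.∣ p ℚ.- q ∣ ≡ ℚ.∣ q ℚ.- p ∣
  ∣p-q∣≡∣q-p∣ p q = trans
    (cong ℚ.∣_∣ (solve 2 (λ p q → p :- q := :- (q :- p)) refl p q))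
    (ℚ.∣-p∣≡∣p∣ (q ℚ.- p))

  p-q<r⇒p<q+r : ∀ p q r → p ℚ.- q ℚ.< r → p ℚ.< q ℚ.+ r
  p-q<r⇒p<q+r p q r lt = subst (ℚ._< q ℚ.+ r)
    (solve 2 (λ p q → q :+ (p :- q) := p) refl p q)
    (ℚ.+-monoʳ-< q lt)

  p<q+r⇒p-q<r : ∀ p q r → p ℚ.< q ℚ.+ r → p ℚ.- q ℚ.< r
  p<q+r⇒p-q<r p q r lt = subst (p ℚ.- q ℚ.<_)
    (solve 2 (λ q r → (q :+ r) :- q := r) refl q r)
    (ℚ.+-monoˡ-< (ℚ.- q) lt)

  near⇒< : ∀ p q {r} → ℚ.∣ p ℚ.- q ∣ ℚ.< r → p ℚ.< q ℚ.+ r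
  near⇒< p q lt = p-q<r⇒p<q+r p q _ (ℚ.≤-<-trans (p≤∣p∣ (p ℚ.- q)) lt)

  <⇒near : ∀ p q {r} → p ℚ.< q ℚ.+ r → q ℚ.< p ℚ.+ r → ℚ.∣ p ℚ.- q ∣ ℚ.< r
  <⇒near p q {r} lt gt = ∣p∣<q (p<q+r⇒p-q<r p q r lt)
    (subst (ℚ._< r) (solve 2 (λ p q → q :- p := :- (p :- q)) refl p q)
      (p<q+r⇒p-q<r q p r gt))

  half-pos : ∀ {ε} → 0ℚ ℚ.< ε → 0ℚ ℚ.< ε ℚ.* ½
  half-pos 0<ε = ℚ.*-monoˡ-<-pos ½ 0<ε

  half+half : ∀ ε → ε ℚ.* ½ ℚ.+ ε ℚ.* ½ ≡ ε
  half+half ε = trans (sym (ℚ.*-distribˡ-+ ε ½ ½)) (ℚ.*-identityʳ ε)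

  divide : ∀ C ε → 0ℚ ℚ.< C → 0ℚ ℚ.< ε →
           Σ[ δ ∈ ℚ ] 0ℚ ℚ.< δ × C ℚ.* δ ≡ ε
  divide C ε 0<C 0<ε = δ , 0<δ , eq
    where
    instance
      C⁺ : ℚ.Positive C
      C⁺ = ℚ.positive 0<C
      C≠0 : ℚ.NonZero C
      C≠0 = ℚ.pos⇒nonZero C
      C⁻¹⁺ : ℚ.Positive (ℚ.1/ C)
      C⁻¹⁺ = ℚ.1/pos⇒pos C
    δ = (ℚ.1/ C) ℚ.* ε
    0<δ : 0ℚ ℚ.< δ
    0<δ = subst (ℚ._< δ) (ℚ.*-zeroʳ (ℚ.1/ C)) (ℚ.*-monoʳ-<-pos (ℚ.1/ C) 0<ε)
    eq : C ℚ.* δ ≡ ε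
    eq = trans (sym (ℚ.*-assoc C (ℚ.1/ C) ε))
         (trans (cong (ℚ._* ε) (ℚ.*-inverseʳ C)) (ℚ.*-identityˡ ε))

  ⊓-near : ∀ p q p′ q′ {ε} → p ℚ.< p′ ℚ.+ ε → q ℚ.< q′ ℚ.+ ε →
           p ℚ.⊓ q ℚ.< (p′ ℚ.⊓ q′) ℚ.+ ε
  ⊓-near p q p′ q′ {ε} lt gt with ℚ.⊓-sel p′ q′
  ... | inj₁ eq = subst (λ r → p ℚ.⊓ q ℚ.< r ℚ.+ ε) (sym eq)
                    (ℚ.≤-<-trans (ℚ.p⊓q≤p p q) lt)
  ... | inj₂ eq = subst (λ r → p ℚ.⊓ q ℚ.< r ℚ.+ ε) (sym eq)
                    (ℚ.≤-<-trans (ℚ.p⊓q≤q p q) gt)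

  ∣p∣≤∣p-q∣+∣q∣ : ∀ p q → ℚ.∣ p ∣ ℚ.≤ ℚ.∣ q ∣ ℚ.+ ℚ.∣ p ℚ.- q ∣
  ∣p∣≤∣p-q∣+∣q∣ p q = subst (λ r → ℚ.∣ r ∣ ℚ.≤ ℚ.∣ q ∣ ℚ.+ ℚ.∣ p ℚ.- q ∣)
    (solve 2 (λ p q → q :+ (p :- q) := p) refl p q)
    (ℚ.∣p+q∣≤∣p∣+∣q∣ q (p ℚ.- q))

  *-near : ∀ p q p′ q′ {B C δ} → 0ℚ ℚ.< B → 0ℚ ℚ.< C →
           ℚ.∣ p ∣ ℚ.< B → ℚ.∣ q′ ∣ ℚ.< C →
           ℚ.∣ p ℚ.- p′ ∣ ℚ.< δ → ℚ.∣ q ℚ.- q′ ∣ ℚ.< δ →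
           ℚ.∣ p ℚ.* q ℚ.- p′ ℚ.* q′ ∣ ℚ.< (B ℚ.+ C) ℚ.* δ
  *-near p q p′ q′ {B} {C} {δ} 0<B 0<C p<B q′<C dp dq = begin-strict
    ℚ.∣ p ℚ.* q ℚ.- p′ ℚ.* q′ ∣
      ≡⟨ cong ℚ.∣_∣ (solve 4 (λ p q p′ q′ →
           p :* q :- p′ :* q′ := p :* (q :- q′) :+ q′ :* (p :- p′)) refl p q p′ q′) ⟩
    ℚ.∣ p ℚ.* (q ℚ.- q′) ℚ.+ q′ ℚ.* (p ℚ.- p′) ∣
      ≤⟨ ℚ.∣p+q∣≤∣p∣+∣q∣ (p ℚ.* (q ℚ.- q′)) (q′ ℚ.* (p ℚ.- p′)) ⟩
    ℚ.∣ p ℚ.* (q ℚ.- q′) ∣ ℚ.+ ℚ.∣ q′ ℚ.* (p ℚ.- p′) ∣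
      <⟨ ℚ.+-mono-< (bound p (q ℚ.- q′) 0<B p<B dq) (bound q′ (p ℚ.- p′) 0<C q′<C dp) ⟩
    B ℚ.* δ ℚ.+ C ℚ.* δ
      ≡⟨ sym (ℚ.*-distribʳ-+ δ B C) ⟩
    (B ℚ.+ C) ℚ.* δ ∎
    where
    open ℚ.≤-Reasoning
    bound : ∀ r s {D} → 0ℚ ℚ.< D → ℚ.∣ r ∣ ℚ.< D → ℚ.∣ s ∣ ℚ.< δ →
            ℚ.∣ r ℚ.* s ∣ ℚ.< D ℚ.* δ
    bound r s {D} 0<D r<D s<δ = begin-strict
      ℚ.∣ r ℚ.* s ∣         ≡⟨ ℚ.∣p*q∣≡∣p∣*∣q∣ r s ⟩
      ℚ.∣ r ∣ ℚ.* ℚ.∣ s ∣   ≤⟨ ℚ.*-monoʳ-≤-nonNeg ℚ.∣ s ∣ {{ℚ.∣-∣-nonNeg s}} (ℚ.<⇒≤ r<D) ⟩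
      D ℚ.* ℚ.∣ s ∣         <⟨ ℚ.*-monoʳ-<-pos D {{ℚ.positive 0<D}} s<δ ⟩
      D ℚ.* δ               ∎

  *-nonNeg-near : ∀ p q {B C δ} → 0ℚ ℚ.< δ → δ ℚ.≤ 1ℚ →
                  ℚ.∣ p ∣ ℚ.< B → ℚ.∣ q ∣ ℚ.< C →
                  0ℚ ℚ.≤ p ℚ.+ δ → 0ℚ ℚ.≤ q ℚ.+ δ →
                  0ℚ ℚ.≤ p ℚ.* q ℚ.+ (B ℚ.+ C ℚ.+ 1ℚ) ℚ.* δ
  *-nonNeg-near p q {B} {C} {δ} 0<δ δ≤1 p<B q<C 0≤p 0≤q = begin
    0ℚ
      ≤⟨ ℚ.nonNegative⁻¹ _ {{ℚ.nonNeg*nonNeg⇒nonNeg (p ℚ.+ δ) {{ℚ.nonNegative 0≤p}}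
                                                     (q ℚ.+ δ) {{ℚ.nonNegative 0≤q}}}} ⟩
    (p ℚ.+ δ) ℚ.* (q ℚ.+ δ)
      ≡⟨ solve 3 (λ p q δ → (p :+ δ) :* (q :+ δ) := p :* q :+ (p :+ q :+ δ) :* δ) refl p q δ ⟩
    p ℚ.* q ℚ.+ (p ℚ.+ q ℚ.+ δ) ℚ.* δ
      ≤⟨ ℚ.+-monoʳ-≤ (p ℚ.* q) (ℚ.*-monoʳ-≤-nonNeg δ {{ℚ.nonNegative (ℚ.<⇒≤ 0<δ)}}
           (ℚ.+-mono-≤ (ℚ.+-mono-≤ (ℚ.≤-trans (p≤∣p∣ p) (ℚ.<⇒≤ p<B))
                                    (ℚ.≤-trans (p≤∣p∣ q) (ℚ.<⇒≤ q<C))) δ≤1)) ⟩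
    p ℚ.* q ℚ.+ (B ℚ.+ C ℚ.+ 1ℚ) ℚ.* δ ∎
    where open ℚ.≤-Reasoning

  ⊓-pos : ∀ p q → 0ℚ ℚ.< p → 0ℚ ℚ.< q → 0ℚ ℚ.< p ℚ.⊓ q
  ⊓-pos p q 0<p 0<q with ℚ.⊓-sel p q
  ... | inj₁ eq = subst (0ℚ ℚ.<_) (sym eq) 0<p
  ... | inj₂ eq = subst (0ℚ ℚ.<_) (sym eq) 0<q

  p≤p+ε : ∀ p {ε} → 0ℚ ℚ.< ε → p ℚ.≤ p ℚ.+ ε
  p≤p+ε p {ε} 0<ε = subst (ℚ._≤ p ℚ.+ ε) (ℚ.+-identityʳ p) (ℚ.+-monoʳ-≤ p (ℚ.<⇒≤ 0<ε))

open Rational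

Eventually : (ℕ → Set) → Set
Eventually P = ∃[ N ] ∀ n → N ℕ.≤ n → P n

module EventuallyLemmas where
  map : ∀ {P Q : ℕ → Set} → (∀ n → P n → Q n) → Eventually P → Eventually Q
  map f (N , p) = N , λ n N≤n → f n (p n N≤n)

  zip : ∀ {P Q R : ℕ → Set} → (∀ n → P n → Q n → R n) →
        Eventually P → Eventually Q → Eventually R
  zip f (N , p) (K , q) = N ℕ.⊔ K , λ n N⊔K≤n →
    f n (p n (ℕ.m⊔n≤o⇒m≤o N K N⊔K≤n)) (q n (ℕ.m⊔n≤o⇒n≤o N K N⊔K≤n))

  always : ∀ {P : ℕ → Set} → (∀ n → P n) → Eventually P
  always p = 0 , λ n _ → p n

open EventuallyLemmas

IsCauchy : (ℕ → ℚ) → Set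
IsCauchy x = ∀ ε → 0ℚ ℚ.< ε →
  ∃[ N ] ∀ m n → N ℕ.≤ m → N ℕ.≤ n → ℚ.∣ x m ℚ.- x n ∣ ℚ.< ε

-- ℝ is a setoid: two Cauchy sequences denote the same real number when
-- they are related by _≈_.
record ℝ : Set where
  constructor mkℝ
  field
    seq    : ℕ → ℚ
    cauchy : IsCauchy seq

open ℝ public

infix 4 _≈_ _≤_ _<_

_≈_ : ℝ → ℝ → Set
x ≈ y = ∀ ε → 0ℚ ℚ.< ε → Eventually λ n → ℚ.∣ seq x n ℚ.- seq y n ∣ ℚ.< ε

_≤_ : ℝ → ℝ → Set
x ≤ y = ∀ ε → 0ℚ ℚ.< ε → Eventually λ n → seq x n ℚ.≤ seq y n ℚ.+ ε

_<_ : ℝ → ℝ → Set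
x < y = ∃[ ε ] 0ℚ ℚ.< ε × Eventually λ n → seq x n ℚ.+ ε ℚ.≤ seq y n

private
  zipCauchy : ∀ (x y z : ℕ → ℚ) ε {δ} → 0ℚ ℚ.< δ →
              (∀ m n → ℚ.∣ x m ℚ.- x n ∣ ℚ.< δ → ℚ.∣ y m ℚ.- y n ∣ ℚ.< δ →
                ℚ.∣ z m ℚ.- z n ∣ ℚ.< ε) →
              IsCauchy x → IsCauchy y →
              ∃[ N ] ∀ m n → N ℕ.≤ m → N ℕ.≤ n → ℚ.∣ z m ℚ.- z n ∣ ℚ.< ε
  zipCauchy x y z ε {δ} 0<δ f cx cy with cx δ 0<δ | cy δ 0<δ
  ... | N , p | K , q = N ℕ.⊔ K , λ m n N⊔K≤m N⊔K≤n → f m n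
    (p m n (ℕ.m⊔n≤o⇒m≤o N K N⊔K≤m) (ℕ.m⊔n≤o⇒m≤o N K N⊔K≤n))
    (q m n (ℕ.m⊔n≤o⇒n≤o N K N⊔K≤m) (ℕ.m⊔n≤o⇒n≤o N K N⊔K≤n))

  bounded : ∀ x → ∃[ B ] 0ℚ ℚ.< B × Eventually λ n → ℚ.∣ seq x n ∣ ℚ.< B
  bounded x with cauchy x 1ℚ (ℚ.positive⁻¹ 1ℚ)
  ... | N , p = ℚ.∣ seq x N ∣ ℚ.+ 1ℚ
              , ℚ.+-mono-≤-< (ℚ.0≤∣p∣ (seq x N)) (ℚ.positive⁻¹ 1ℚ)
              , N , λ n N≤n → ℚ.≤-<-trans (∣p∣≤∣p-q∣+∣q∣ (seq x n) (seq x N))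
                                (ℚ.+-monoʳ-< ℚ.∣ seq x N ∣ (p n N N≤n ℕ.≤-refl))

fromℚ : ℚ → ℝ
fromℚ q = mkℝ (λ _ → q) λ ε 0<ε → 0 , λ _ _ _ _ →
  subst (ℚ._< ε) (sym (cong ℚ.∣_∣ (ℚ.+-inverseʳ q))) 0<ε

0ℝ 1ℝ : ℝ
0ℝ = fromℚ 0ℚ
1ℝ = fromℚ 1ℚ

infixl 6 _+_ _-_
infixl 7 _*_

_+_ : ℝ → ℝ → ℝ
x + y = mkℝ (λ n → seq x n ℚ.+ seq y n) λ ε 0<ε →
  zipCauchy (seq x) (seq y) (λ n → seq x n ℚ.+ seq y n) ε (half-pos 0<ε)
    (λ m n dx dy → near ε (seq x m) (seq y m) (seq x n) (seq y n) dx dy)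
    (cauchy x) (cauchy y)
  where
  near : ∀ ε p q p′ q′ → ℚ.∣ p ℚ.- p′ ∣ ℚ.< ε ℚ.* ½ → ℚ.∣ q ℚ.- q′ ∣ ℚ.< ε ℚ.* ½ →
         ℚ.∣ (p ℚ.+ q) ℚ.- (p′ ℚ.+ q′) ∣ ℚ.< ε
  near ε p q p′ q′ dp dq = subst₂ ℚ._<_
    (cong ℚ.∣_∣ (solve 4 (λ p q p′ q′ → (p :- p′) :+ (q :- q′) := (p :+ q) :- (p′ :+ q′))
      refl p q p′ q′))
    (half+half ε)
    (ℚ.≤-<-trans (ℚ.∣p+q∣≤∣p∣+∣q∣ (p ℚ.- p′) (q ℚ.- q′)) (ℚ.+-mono-< dp dq))

-_ : ℝ → ℝ
- x = mkℝ (λ n → ℚ.- seq x n) λ ε 0<ε → let (N , p) = cauchy x ε 0<ε in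
  N , λ m n N≤m N≤n → subst (ℚ._< ε)
    (cong ℚ.∣_∣ (solve 2 (λ p q → q :- p := (:- p) :- (:- q)) refl (seq x m) (seq x n)))
    (p n m N≤n N≤m)

_-_ : ℝ → ℝ → ℝ
x - y = x + (- y)

_*_ : ℝ → ℝ → ℝ
x * y = mkℝ (λ n → seq x n ℚ.* seq y n) isCauchy
  where
  isCauchy : IsCauchy (λ n → seq x n ℚ.* seq y n)
  isCauchy ε 0<ε =
    let (B , 0<B , N , x<B) = bounded x
        (C , 0<C , K , y<C) = bounded y
        (δ , 0<δ , eq)      = divide (B ℚ.+ C) ε (ℚ.+-mono-< 0<B 0<C) 0<ε
        (N′ , dx)           = cauchy x δ 0<δ
        (K′ , dy)           = cauchy y δ 0<δ
    in
    (N ℕ.⊔ K) ℕ.⊔ (N′ ℕ.⊔ K′) , λ m n ≤m ≤n →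
    let m₁ = ℕ.m⊔n≤o⇒m≤o (N ℕ.⊔ K) (N′ ℕ.⊔ K′) ≤m
        m₂ = ℕ.m⊔n≤o⇒n≤o (N ℕ.⊔ K) (N′ ℕ.⊔ K′) ≤m
        n₁ = ℕ.m⊔n≤o⇒m≤o (N ℕ.⊔ K) (N′ ℕ.⊔ K′) ≤n
        n₂ = ℕ.m⊔n≤o⇒n≤o (N ℕ.⊔ K) (N′ ℕ.⊔ K′) ≤n
    in
    subst (ℚ.∣ seq x m ℚ.* seq y m ℚ.- seq x n ℚ.* seq y n ∣ ℚ.<_) eq
      (*-near (seq x m) (seq y m) (seq x n) (seq y n) 0<B 0<C
        (x<B m (ℕ.m⊔n≤o⇒m≤o N K m₁)) (y<C n (ℕ.m⊔n≤o⇒n≤o N K n₁))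
        (dx m n (ℕ.m⊔n≤o⇒m≤o N′ K′ m₂) (ℕ.m⊔n≤o⇒m≤o N′ K′ n₂))
        (dy m n (ℕ.m⊔n≤o⇒n≤o N′ K′ m₂) (ℕ.m⊔n≤o⇒n≤o N′ K′ n₂)))

min : ℝ → ℝ → ℝ
min x y = mkℝ (λ n → seq x n ℚ.⊓ seq y n) λ ε 0<ε →
  zipCauchy (seq x) (seq y) (λ n → seq x n ℚ.⊓ seq y n) ε 0<ε
    (λ m n dx dy → near (seq x m) (seq y m) (seq x n) (seq y n) dx dy)
    (cauchy x) (cauchy y)
  where
  near : ∀ p q p′ q′ {ε} → ℚ.∣ p ℚ.- p′ ∣ ℚ.< ε → ℚ.∣ q ℚ.- q′ ∣ ℚ.< ε →
         ℚ.∣ (p ℚ.⊓ q) ℚ.- (p′ ℚ.⊓ q′) ∣ ℚ.< ε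
  near p q p′ q′ {ε} dp dq = <⇒near (p ℚ.⊓ q) (p′ ℚ.⊓ q′)
    (⊓-near p q p′ q′ (near⇒< p p′ dp) (near⇒< q q′ dq))
    (⊓-near p′ q′ p q (near⇒< p′ p (subst (ℚ._< ε) (∣p-q∣≡∣q-p∣ p p′) dp))
                      (near⇒< q′ q (subst (ℚ._< ε) (∣p-q∣≡∣q-p∣ q q′) dq)))

∣_∣ : ℝ → ℝ
∣ x ∣ = mkℝ (λ n → ℚ.∣ seq x n ∣) λ ε 0<ε → let (N , p) = cauchy x ε 0<ε in
  N , λ m n N≤m N≤n → <⇒near ℚ.∣ seq x m ∣ ℚ.∣ seq x n ∣
    (ℚ.≤-<-trans (∣p∣≤∣p-q∣+∣q∣ (seq x m) (seq x n))
      (ℚ.+-monoʳ-< ℚ.∣ seq x n ∣ (p m n N≤m N≤n)))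
    (ℚ.≤-<-trans (∣p∣≤∣p-q∣+∣q∣ (seq x n) (seq x m))
      (ℚ.+-monoʳ-< ℚ.∣ seq x m ∣ (p n m N≤n N≤m)))

IsOpenℝ : Pred ℝ 0ℓ → Set
IsOpenℝ V = ∀ x → V x → ∃[ ε ] 0ℝ < ε × (∀ y → ∣ y - x ∣ < ε → V y)

private
  min≤ˡ : ∀ x y → min x y ≤ x
  min≤ˡ x y ε 0<ε = always λ n →
    ℚ.≤-trans (ℚ.p⊓q≤p (seq x n) (seq y n)) (p≤p+ε (seq x n) 0<ε)

  0≤min : ∀ x y → 0ℝ ≤ x → 0ℝ ≤ y → 0ℝ ≤ min x y
  0≤min x y 0≤x 0≤y ε 0<ε = zip (λ n → lemma (seq x n) (seq y n)) (0≤x ε 0<ε) (0≤y ε 0<ε)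
    where
    lemma : ∀ p q → 0ℚ ℚ.≤ p ℚ.+ ε → 0ℚ ℚ.≤ q ℚ.+ ε → 0ℚ ℚ.≤ (p ℚ.⊓ q) ℚ.+ ε
    lemma p q 0≤p 0≤q with ℚ.⊓-sel p q
    ... | inj₁ eq = subst (λ r → 0ℚ ℚ.≤ r ℚ.+ ε) (sym eq) 0≤p
    ... | inj₂ eq = subst (λ r → 0ℚ ℚ.≤ r ℚ.+ ε) (sym eq) 0≤q

  0≤+ : ∀ x y → 0ℝ ≤ x → 0ℝ ≤ y → 0ℝ ≤ x + y
  0≤+ x y 0≤x 0≤y ε 0<ε = zip (λ n → lemma (seq x n) (seq y n))
    (0≤x (ε ℚ.* ½) (half-pos 0<ε)) (0≤y (ε ℚ.* ½) (half-pos 0<ε))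
    where
    lemma : ∀ p q → 0ℚ ℚ.≤ p ℚ.+ ε ℚ.* ½ → 0ℚ ℚ.≤ q ℚ.+ ε ℚ.* ½ → 0ℚ ℚ.≤ (p ℚ.+ q) ℚ.+ ε
    lemma p q 0≤p 0≤q = subst (0ℚ ℚ.≤_)
      (trans (solve 3 (λ p q δ → (p :+ δ) :+ (q :+ δ) := (p :+ q) :+ (δ :+ δ)) refl p q (ε ℚ.* ½))
             (cong ((p ℚ.+ q) ℚ.+_) (half+half ε)))
      (ℚ.+-mono-≤ 0≤p 0≤q)

  0≤* : ∀ x y → 0ℝ ≤ x → 0ℝ ≤ y → 0ℝ ≤ x * y
  0≤* x y 0≤x 0≤y ε 0<ε =
    let (B , 0<B , x<B) = bounded x
        (C , 0<C , y<C) = bounded y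
        D               = B ℚ.+ C ℚ.+ 1ℚ
        0<D             = ℚ.+-mono-< (ℚ.+-mono-< 0<B 0<C) (ℚ.positive⁻¹ 1ℚ)
        (δ , 0<δ , eq)  = divide D ε 0<D 0<ε
        0<δ⊓1           = ⊓-pos δ 1ℚ 0<δ (ℚ.positive⁻¹ 1ℚ)
        Dδ′≤ε           = subst (D ℚ.* (δ ℚ.⊓ 1ℚ) ℚ.≤_) eq
                            (ℚ.*-monoˡ-≤-nonNeg D {{ℚ.nonNegative (ℚ.<⇒≤ 0<D)}} (ℚ.p⊓q≤p δ 1ℚ))
    in zip (λ n (p<B , q<C) (0≤p , 0≤q) →
         ℚ.≤-trans (*-nonNeg-near (seq x n) (seq y n) 0<δ⊓1 (ℚ.p⊓q≤q δ 1ℚ) p<B q<C 0≤p 0≤q)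
                   (ℚ.+-monoʳ-≤ (seq x n ℚ.* seq y n) Dδ′≤ε))
       (zip (λ _ → _,_) x<B y<C)
       (zip (λ _ → _,_) (0≤x (δ ℚ.⊓ 1ℚ) 0<δ⊓1) (0≤y (δ ℚ.⊓ 1ℚ) 0<δ⊓1))

record ℝ≥0 : Set where
  constructor mkℝ≥0
  field
    real   : ℝ
    0≤real : 0ℝ ≤ real

open ℝ≥0 public

0ℝ≥0 : ℝ≥0
0ℝ≥0 = mkℝ≥0 0ℝ λ ε 0<ε → always λ _ → p≤p+ε 0ℚ 0<ε

_+≥0_ : ℝ≥0 → ℝ≥0 → ℝ≥0
x +≥0 y = mkℝ≥0 (real x + real y) (0≤+ (real x) (real y) (0≤real x) (0≤real y))

_*≥0_ : ℝ≥0 → ℝ≥0 → ℝ≥0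
x *≥0 y = mkℝ≥0 (real x * real y) (0≤* (real x) (real y) (0≤real x) (0≤real y))

-- The term aₙ (n ≥ 1) of a series is represented by a (n - 1), so that
-- sumOfFirst k a is a₁ + ⋯ + aₖ.
sumOfFirst : ℕ → (ℕ → ℝ≥0) → ℝ≥0
sumOfFirst zero    a = 0ℝ≥0
sumOfFirst (suc k) a = sumOfFirst k a +≥0 a k

module 𝐀 (M : ℝ) (1≤M : 1ℝ ≤ M) where

  record Carrier : Set where
    constructor mkCarrier
    field
      value   : ℝ
      0≤value : 0ℝ ≤ value
      value≤M : value ≤ M

  open Carrier public

  private
    0≤M : 0ℝ ≤ M
    0≤M ε 0<ε = map (λ _ → ℚ.≤-trans (ℚ.<⇒≤ (ℚ.positive⁻¹ 1ℚ))) (1≤M ε 0<ε)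

  h : ℝ≥0 → Carrier
  h a = mkCarrier (min M (real a)) (0≤min M (real a) 0≤M (0≤real a)) (min≤ˡ M (real a))

  ι : Carrier → ℝ≥0
  ι a = mkℝ≥0 (value a) (0≤value a)

  infixl 6 _⊕_
  infixl 7 _⊗_
  infix  4 _≤ᴹ_

  _⊕_ _⊗_ : Carrier → Carrier → Carrier
  a ⊕ b = h (ι a +≥0 ι b)
  a ⊗ b = h (ι a *≥0 ι b)

  _≤ᴹ_ : Carrier → Carrier → Set
  a ≤ᴹ b = value a ≤ value b

  -- The subspace topology induced from ℝ.
  IsOpen : Pred Carrier 0ℓ → Set₁
  IsOpen U = Σ[ V ∈ Pred ℝ 0ℓ ] IsOpenℝ V × (∀ a → U a ⇔ V (value a))

  _ConvergesTo_ : (ℕ → Carrier) → Carrier → Set₁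
  s ConvergesTo l = ∀ U → IsOpen U → U l → Eventually λ k → U (s k)

  Converges : (ℕ → Carrier) → Set₁
  Converges s = Σ[ l ∈ Carrier ] s ConvergesTo l

  -- Position k holds h (a₁ + ⋯ + aₖ₊₁): the first partial sum has one term.
  weakProjection : (ℕ → ℝ≥0) → (ℕ → Carrier)
  weakProjection a k = h (sumOfFirst (suc k) a)

{-# OPTIONS --safe #-}
module Submission where

-- Replace the k-th term of a monotone bounded sequence of reals by a rational
-- qₖ within 1/(k+1) of it.  The sequence q is bounded and almost monotone, so
-- for every ε excluded middle provides an index N beyond which q never exceeds
-- q_N + ε: otherwise q would climb by ε infinitely often.  Hence q is a Cauchy
-- sequence of rationals, and the real number it represents is the limit.

open import Defs
open Rational
open EventuallyLemmas
open import Data.Nat.Base as ℕ using (ℕ; zero; suc)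
import Data.Nat.Properties as ℕ
open import Data.Nat.Coprimality using (1-coprimeTo) renaming (sym to coprime-sym)
open import Data.Integer.Base as ℤ using (+_; +[1+_]; -[1+_]; 1ℤ)
import Data.Integer.Properties as ℤ
import Data.Integer.Solver as ℤ-Solver
open import Data.Product.Base using (Σ-syntax; ∃-syntax; _×_; _,_; proj₁; proj₂)
open import Data.Rational.Base as ℚ using (ℚ; 0ℚ; 1ℚ; ½; mkℚ)
import Data.Rational.Properties as ℚ
open import Data.Rational.Solver using (module +-*-Solver)
import Data.Rational.Unnormalised.Base as ℚᵘ
import Data.Rational.Unnormalised.Properties as ℚᵘ
open import Function.Bundles using (module Equivalence)
open import Level using (0ℓ)
open import Axiom.ExcludedMiddle using (ExcludedMiddle)
open import Relation.Binary.PropositionalEquality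
  using (_≡_; refl; sym; trans; cong; subst)
open import Relation.Nullary using (yes; no; contradiction)

open +-*-Solver using (solve; _:+_; _:*_; _:-_; _:=_; con)

-- Archimedean property and ε-arithmetic in the rationals.

fromℕ : ℕ → ℚ
fromℕ n = mkℚ (+ n) 0 (coprime-sym (1-coprimeTo n))

1/suc : ℕ → ℚ
1/suc n = mkℚ (+ 1) n (1-coprimeTo (suc n))

0<1/suc : ∀ n → 0ℚ ℚ.< 1/suc n
0<1/suc n = ℚ.positive⁻¹ (1/suc n)

-- Addition on `ℚ` cancels common factors and does not reduce for a variable `n`, so the equation is
-- checked on unnormalised fractions.
fromℕ-suc : ∀ n → fromℕ (suc n) ≡ fromℕ n ℚ.+ 1ℚ
fromℕ-suc n = ℚ.toℚᵘ-injective (ℚᵘ.≃-trans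
  (ℚᵘ.*≡* (IS.solve 1 (λ n → (IS.con 1ℤ IS.:+ n) IS.:* IS.con 1ℤ IS.:=
    (n IS.:* IS.con 1ℤ IS.:+ IS.con 1ℤ IS.:* IS.con 1ℤ) IS.:* IS.con 1ℤ) refl (+ n)))
  (ℚᵘ.≃-sym (ℚ.toℚᵘ-homo-+ (fromℕ n) 1ℚ)))
  where module IS = ℤ-Solver.+-*-Solver

≤fromℕ : ∀ p → ∃[ n ] p ℚ.≤ fromℕ n
-- The denominator is at least 1, so the numerator is already an upper bound.
≤fromℕ (mkℚ (+ n) d _) = n , ℚ.*≤* (ℤ.*-monoˡ-≤-nonNeg (+ n) (ℤ.+≤+ (ℕ.s≤s ℕ.z≤n)))
≤fromℕ p@(mkℚ -[1+ _ ] _ _) = 0 , ℚ.<⇒≤ (ℚ.negative⁻¹ p)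

archimedean : ∀ p ε → 0ℚ ℚ.< ε → ∃[ n ] p ℚ.< ε ℚ.* fromℕ n
archimedean p ε 0<ε =
  let (δ , _ , εδ≡∣p∣+1) = divide ε (ℚ.∣ p ∣ ℚ.+ 1ℚ) 0<ε
                             (ℚ.+-mono-≤-< (ℚ.0≤∣p∣ p) (ℚ.positive⁻¹ 1ℚ))
      (n , δ≤n) = ≤fromℕ δ
  in n , (begin-strict
    p                 ≤⟨ p≤∣p∣ p ⟩
    ℚ.∣ p ∣           ≡⟨ ℚ.+-identityʳ ℚ.∣ p ∣ ⟨
    ℚ.∣ p ∣ ℚ.+ 0ℚ    <⟨ ℚ.+-monoʳ-< ℚ.∣ p ∣ (ℚ.positive⁻¹ 1ℚ) ⟩
    ℚ.∣ p ∣ ℚ.+ 1ℚ    ≡⟨ εδ≡∣p∣+1 ⟨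
    ε ℚ.* δ           ≤⟨ ℚ.*-monoˡ-≤-nonNeg ε {{ℚ.nonNegative (ℚ.<⇒≤ 0<ε)}} δ≤n ⟩
    ε ℚ.* fromℕ n     ∎)
  where open ℚ.≤-Reasoning

1/suc-eventually-≤ : ∀ ε → 0ℚ ℚ.< ε → Eventually λ n → 1/suc n ℚ.≤ ε
1/suc-eventually-≤ (mkℚ (+ zero) _ _) 0<ε with () ← ℚ.positive 0<ε
1/suc-eventually-≤ (mkℚ -[1+ _ ] _ _) 0<ε with () ← ℚ.positive 0<ε
-- For ε = (a+1)/(d+1) and n ≥ d, 1/(n+1) ≤ 1/(d+1) ≤ ε.
1/suc-eventually-≤ (mkℚ +[1+ a ] d _) _ = d , λ n d≤n →
  ℚ.*≤* (ℤ.+≤+ (ℕ.*-mono-≤ {1} {suc a} (ℕ.s≤s ℕ.z≤n) (ℕ.s≤s d≤n)))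

third : ∀ ε → 0ℚ ℚ.< ε → Σ[ δ ∈ ℚ ] 0ℚ ℚ.< δ × δ ℚ.+ δ ℚ.+ δ ≡ ε
third ε 0<ε =
  let (δ , 0<δ , 3δ≡ε) = divide (1ℚ ℚ.+ 1ℚ ℚ.+ 1ℚ) ε (ℚ.positive⁻¹ _) 0<ε
  in δ , 0<δ , trans (solve 1 (λ δ → δ :+ δ :+ δ :=
       (con 1ℚ :+ con 1ℚ :+ con 1ℚ) :* δ) refl δ) 3δ≡ε

near-sym : ∀ p q {r} → ℚ.∣ p ℚ.- q ∣ ℚ.< r → ℚ.∣ q ℚ.- p ∣ ℚ.< r
near-sym p q {r} = subst (ℚ._< r) (∣p-q∣≡∣q-p∣ p q)

near-trans : ∀ p q r {δ ε} → ℚ.∣ p ℚ.- q ∣ ℚ.< δ → ℚ.∣ q ℚ.- r ∣ ℚ.< ε →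
             ℚ.∣ p ℚ.- r ∣ ℚ.< δ ℚ.+ ε
near-trans p q r {δ} {ε} dpq dqr = subst (λ t → ℚ.∣ t ∣ ℚ.< δ ℚ.+ ε)
  (solve 3 (λ p q r → (p :- q) :+ (q :- r) := p :- r) refl p q r)
  (ℚ.≤-<-trans (ℚ.∣p+q∣≤∣p∣+∣q∣ (p ℚ.- q) (q ℚ.- r)) (ℚ.+-mono-< dpq dqr))

-- Order on the reals.

≤-refl : ∀ {x} → x ≤ x
≤-refl {x} ε 0<ε = always λ n → p≤p+ε (seq x n) 0<ε

≤-trans : ∀ {x y z} → x ≤ y → y ≤ z → x ≤ z
≤-trans {x} {y} {z} x≤y y≤z ε 0<ε =
  zip (λ n → step (seq x n) (seq y n) (seq z n))
    (x≤y (ε ℚ.* ½) (half-pos 0<ε)) (y≤z (ε ℚ.* ½) (half-pos 0<ε))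
  where
  open ℚ.≤-Reasoning
  step : ∀ p q r → p ℚ.≤ q ℚ.+ ε ℚ.* ½ → q ℚ.≤ r ℚ.+ ε ℚ.* ½ → p ℚ.≤ r ℚ.+ ε
  step p q r p≤q q≤r = begin
    p                               ≤⟨ p≤q ⟩
    q ℚ.+ ε ℚ.* ½                   ≤⟨ ℚ.+-monoˡ-≤ (ε ℚ.* ½) q≤r ⟩
    r ℚ.+ ε ℚ.* ½ ℚ.+ ε ℚ.* ½       ≡⟨ ℚ.+-assoc r (ε ℚ.* ½) (ε ℚ.* ½) ⟩
    r ℚ.+ (ε ℚ.* ½ ℚ.+ ε ℚ.* ½)     ≡⟨ cong (r ℚ.+_) (half+half ε) ⟩
    r ℚ.+ ε                         ∎

x≤x+y : ∀ x y → 0ℝ ≤ y → x ≤ x + y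
x≤x+y x y 0≤y ε 0<ε = map (λ n → step (seq x n) (seq y n)) (0≤y ε 0<ε)
  where
  open ℚ.≤-Reasoning
  step : ∀ p q → 0ℚ ℚ.≤ q ℚ.+ ε → p ℚ.≤ p ℚ.+ q ℚ.+ ε
  step p q 0≤q+ε = begin
    p                   ≡⟨ ℚ.+-identityʳ p ⟨
    p ℚ.+ 0ℚ            ≤⟨ ℚ.+-monoʳ-≤ p 0≤q+ε ⟩
    p ℚ.+ (q ℚ.+ ε)     ≡⟨ ℚ.+-assoc p q ε ⟨
    p ℚ.+ q ℚ.+ ε       ∎

min-monoʳ-≤ : ∀ z {x y} → x ≤ y → min z x ≤ min z y
min-monoʳ-≤ z {x} {y} x≤y ε 0<ε =
  map (λ n → step (seq z n) (seq x n) (seq y n)) (x≤y ε 0<ε)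
  where
  open ℚ.≤-Reasoning
  step : ∀ r p q → p ℚ.≤ q ℚ.+ ε → r ℚ.⊓ p ℚ.≤ (r ℚ.⊓ q) ℚ.+ ε
  step r p q p≤q+ε = begin
    -- Weakening `r` to `r + ε` as well lets ε be pulled out of the minimum.
    r ℚ.⊓ p                     ≤⟨ ℚ.⊓-mono-≤ (p≤p+ε r 0<ε) p≤q+ε ⟩
    (r ℚ.+ ε) ℚ.⊓ (q ℚ.+ ε)     ≡⟨ ℚ.mono-≤-distrib-⊓ (ℚ.+-monoˡ-≤ ε) r q ⟨
    (r ℚ.⊓ q) ℚ.+ ε             ∎

-- Rational approximations of reals.

Approx : ℝ → ℚ → ℚ → Set
Approx x q ε = Eventually λ n → ℚ.∣ seq x n ℚ.- q ∣ ℚ.< ε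

approximate : ∀ x ε → 0ℚ ℚ.< ε → ∃[ q ] Approx x q ε
approximate x ε 0<ε = let (N , near) = cauchy x ε 0<ε in
  seq x N , N , λ n N≤n → near n N N≤n ℕ.≤-refl

seq-approximates : ∀ x ε → 0ℚ ℚ.< ε → Eventually λ n → Approx x (seq x n) ε
seq-approximates x ε 0<ε = let (N , near) = cauchy x ε 0<ε in
  N , λ n N≤n → N , λ m N≤m → near m n N≤m N≤n

-- One δ each for passing from `p` to `x`, from `x` to `y`, and from `y` to `q`. Since `p` and `q`
-- are fixed, a single common index suffices.
approx-<-+3δ : ∀ x y p q {δ} → x ≤ y → 0ℚ ℚ.< δ → Approx x p δ → Approx y q δ →
               p ℚ.< q ℚ.+ (δ ℚ.+ δ ℚ.+ δ)
approx-<-+3δ x y p q {δ} x≤y 0<δ x≈p y≈q =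
  let (N , bound) = zip (λ n x≤y (x≈p , y≈q) → step (seq x n) (seq y n) x≤y x≈p y≈q)
                      (x≤y δ 0<δ) (zip (λ _ → _,_) x≈p y≈q)
  in bound N ℕ.≤-refl
  where
  open ℚ.≤-Reasoning
  step : ∀ r s → r ℚ.≤ s ℚ.+ δ → ℚ.∣ r ℚ.- p ∣ ℚ.< δ → ℚ.∣ s ℚ.- q ∣ ℚ.< δ →
         p ℚ.< q ℚ.+ (δ ℚ.+ δ ℚ.+ δ)
  step r s r≤s+δ r≈p s≈q = begin-strict
    p                             <⟨ near⇒< p r (near-sym r p r≈p) ⟩
    r ℚ.+ δ                       ≤⟨ ℚ.+-monoˡ-≤ δ r≤s+δ ⟩
    s ℚ.+ δ ℚ.+ δ                 <⟨ ℚ.+-monoˡ-< δ (ℚ.+-monoˡ-< δ (near⇒< s q s≈q)) ⟩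
    q ℚ.+ δ ℚ.+ δ ℚ.+ δ           ≡⟨ solve 2 (λ q δ → q :+ δ :+ δ :+ δ := q :+ (δ :+ δ :+ δ))
                                       refl q δ ⟩
    q ℚ.+ (δ ℚ.+ δ ℚ.+ δ)         ∎

-- Bounded rational sequences and excluded middle.

module _ (em : ExcludedMiddle 0ℓ) where

  almost-maximum : ∀ (q : ℕ → ℚ) C N₀ → (∀ n → N₀ ℕ.≤ n → q n ℚ.< C) →
                   ∀ ε → 0ℚ ℚ.< ε →
                   ∃[ N ] N₀ ℕ.≤ N × (∀ n → N ℕ.≤ n → q n ℚ.≤ q N ℚ.+ ε)
  almost-maximum q C N₀ q<C ε 0<ε
    with em {∃[ N ] N₀ ℕ.≤ N × (∀ n → N ℕ.≤ n → q n ℚ.≤ q N ℚ.+ ε)}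
  ... | yes max = max
  ... | no ¬max =
    -- `j` climbs of height ε starting from `q N₀` carry the sequence past the bound `C`.
    let (j , C-q<εj)        = archimedean (C ℚ.- q N₀) ε 0<ε
        (N , N₀≤N , climbed) = climb j
    in contradiction
         (ℚ.<-≤-trans (p-q<r⇒p<q+r C (q N₀) (ε ℚ.* fromℕ j) C-q<εj) climbed)
         (ℚ.<-asym (q<C N N₀≤N))
    where
    open ℚ.≤-Reasoning

    exceeds : ∀ N → N₀ ℕ.≤ N → ∃[ n ] N ℕ.≤ n × q N ℚ.+ ε ℚ.< q n
    exceeds N N₀≤N with em {∃[ n ] N ℕ.≤ n × q N ℚ.+ ε ℚ.< q n}
    ... | yes ex = ex
    -- If nothing after `N` exceeded `q N + ε`, then `N` itself would be the index that `¬max` rules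
    -- out.
    ... | no ¬ex = contradiction
      (N , N₀≤N , λ n N≤n → ℚ.≮⇒≥ λ lt → ¬ex (n , N≤n , lt)) ¬max

    climb : ∀ j → ∃[ N ] N₀ ℕ.≤ N × q N₀ ℚ.+ ε ℚ.* fromℕ j ℚ.≤ q N
    climb zero = N₀ , ℕ.≤-refl , ℚ.≤-reflexive
      (trans (cong (q N₀ ℚ.+_) (ℚ.*-zeroʳ ε)) (ℚ.+-identityʳ (q N₀)))
    climb (suc j) =
      let (N , N₀≤N , climbed) = climb j
          (n , N≤n , q<q)      = exceeds N N₀≤N
      in n , ℕ.≤-trans N₀≤N N≤n , (begin
        q N₀ ℚ.+ ε ℚ.* fromℕ (suc j)
          ≡⟨ cong (λ r → q N₀ ℚ.+ ε ℚ.* r) (fromℕ-suc j) ⟩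
        q N₀ ℚ.+ ε ℚ.* (fromℕ j ℚ.+ 1ℚ)
          ≡⟨ solve 3 (λ q ε j → q :+ ε :* (j :+ con 1ℚ) := q :+ ε :* j :+ ε)
               refl (q N₀) ε (fromℕ j) ⟩
        q N₀ ℚ.+ ε ℚ.* fromℕ j ℚ.+ ε
          ≤⟨ ℚ.+-monoˡ-≤ ε climbed ⟩
        q N ℚ.+ ε
          ≤⟨ ℚ.<⇒≤ q<q ⟩
        q n ∎)

-- Monotone convergence for real sequences.

module MonotoneConvergence (em : ExcludedMiddle 0ℓ) (s : ℕ → ℝ) (A B : ℝ)
  (mono : ∀ {k l} → k ℕ.≤ l → s k ≤ s l)
  (A≤s : ∀ k → A ≤ s k) (s≤B : ∀ k → s k ≤ B) where

  q : ℕ → ℚ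
  q k = proj₁ (approximate (s k) (1/suc k) (0<1/suc k))

  s≈q : ∀ ε → 0ℚ ℚ.< ε → Eventually λ k → Approx (s k) (q k) ε
  s≈q ε 0<ε = map
    (λ k 1/k≤ε → map (λ _ lt → ℚ.<-≤-trans lt 1/k≤ε)
      (proj₂ (approximate (s k) (1/suc k) (0<1/suc k))))
    (1/suc-eventually-≤ ε 0<ε)

  q-almost-monotone : ∀ ε → 0ℚ ℚ.< ε →
    ∃[ N ] (∀ k l → N ℕ.≤ k → k ℕ.≤ l → q k ℚ.< q l ℚ.+ ε)
  q-almost-monotone ε 0<ε =
    let (δ , 0<δ , 3δ≡ε) = third ε 0<ε
        (N , near)       = s≈q δ 0<δ
    in N , λ k l N≤k k≤l → subst (λ r → q k ℚ.< q l ℚ.+ r) 3δ≡ε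
         (approx-<-+3δ (s k) (s l) (q k) (q l) (mono k≤l) 0<δ
           (near k N≤k) (near l (ℕ.≤-trans N≤k k≤l)))

  -- The indices `k` and `n` are independent: freezing `n` bounds `q` by a constant, while `n = k`
  -- gives `limit ≤ B`.
  q≤B : ∀ ε → 0ℚ ℚ.< ε → ∃[ N ] (∀ k n → N ℕ.≤ k → N ℕ.≤ n → q k ℚ.< seq B n ℚ.+ ε)
  q≤B ε 0<ε =
    let (δ , 0<δ , 3δ≡ε) = third ε 0<ε
        (N , nearS)      = s≈q δ 0<δ
        (K , nearB)      = seq-approximates B δ 0<δ
    in N ℕ.⊔ K , λ k n ≤k ≤n → subst (λ r → q k ℚ.< seq B n ℚ.+ r) 3δ≡ε
         (approx-<-+3δ (s k) B (q k) (seq B n) (s≤B k) 0<δ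
           (nearS k (ℕ.m⊔n≤o⇒m≤o N K ≤k)) (nearB n (ℕ.m⊔n≤o⇒n≤o N K ≤n)))

  q-cauchy : IsCauchy q
  q-cauchy ε 0<ε =
    let 0<ε/2              = half-pos 0<ε
        (N₁ , almostMono)  = q-almost-monotone (ε ℚ.* ½) 0<ε/2
        (N₂ , bound)       = q≤B 1ℚ (ℚ.positive⁻¹ 1ℚ)
        -- Beyond `N₀` the sequence is both almost monotone and bounded, so the almost maximum found
        -- there can be compared with all later terms.
        N₀                 = N₁ ℕ.⊔ N₂
        (N , N₀≤N , max)   = almost-maximum em q (seq B N₂ ℚ.+ 1ℚ) N₀
                               (λ n N₀≤n → bound n N₂ (ℕ.m⊔n≤o⇒n≤o N₁ N₂ N₀≤n) ℕ.≤-refl)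
                               (ε ℚ.* ½) 0<ε/2
        -- Half of ε pays for rising from `q N` to `q m`, the other half for falling from `q N` to
        -- `q n`. Exchanging `m` and `n` bounds the distance.
        below : ∀ m n → N ℕ.≤ m → N ℕ.≤ n → q m ℚ.< q n ℚ.+ ε
        below m n N≤m N≤n = begin-strict
          q m                               ≤⟨ max m N≤m ⟩
          q N ℚ.+ ε ℚ.* ½                   <⟨ ℚ.+-monoˡ-< (ε ℚ.* ½)
                                                 (almostMono N n (ℕ.m⊔n≤o⇒m≤o N₁ N₂ N₀≤N) N≤n) ⟩
          q n ℚ.+ ε ℚ.* ½ ℚ.+ ε ℚ.* ½       ≡⟨ ℚ.+-assoc (q n) (ε ℚ.* ½) (ε ℚ.* ½) ⟩
          q n ℚ.+ (ε ℚ.* ½ ℚ.+ ε ℚ.* ½)     ≡⟨ cong (q n ℚ.+_) (half+half ε) ⟩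
          q n ℚ.+ ε                         ∎
    in N , λ m n N≤m N≤n → <⇒near (q m) (q n) (below m n N≤m N≤n) (below n m N≤n N≤m)
    where open ℚ.≤-Reasoning

  limit : ℝ
  limit = mkℝ q q-cauchy

  limit≤B : limit ≤ B
  limit≤B ε 0<ε = let (N , bound) = q≤B ε 0<ε in
    N , λ n N≤n → ℚ.<⇒≤ (bound n n N≤n N≤n)

  A≤limit : A ≤ limit
  A≤limit ε 0<ε =
    let (δ , 0<δ , 3δ≡ε) = third ε 0<ε
    in zip (λ n A≈ s≈ → ℚ.<⇒≤ (subst (λ r → seq A n ℚ.< q n ℚ.+ r) 3δ≡ε
                           (approx-<-+3δ A (s n) (seq A n) (q n) (A≤s n) 0<δ A≈ s≈)))
         (seq-approximates A δ 0<δ) (s≈q δ 0<δ)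

  converges : ∀ ε → 0ℝ < ε → Eventually λ k → ∣ s k - limit ∣ < ε
  converges ε (e , 0<e , e≤ε) =
    -- One third covers the distance from `s k` to `q k`, one the distance from `q k` to later terms
    -- of `q`; the last is the gap that witnesses the strict inequality.
    let (δ , 0<δ , 3δ≡e) = third e 0<e
        (N , cauchyq)    = q-cauchy δ 0<δ
    in zip (λ k s≈qk N≤k → δ , 0<δ ,
             zip (λ n (sk≈qk , 0+e≤ε) N≤n → step (seq (s k) n) (q k) (q n) 3δ≡e
                    sk≈qk (cauchyq k n N≤k N≤n) 0+e≤ε)
               (zip (λ _ → _,_) s≈qk e≤ε) (N , λ _ N≤n → N≤n))
         (s≈q δ 0<δ) (N , λ _ N≤k → N≤k)
    where
    open ℚ.≤-Reasoning
    step : ∀ p r t {δ u} → δ ℚ.+ δ ℚ.+ δ ≡ e → ℚ.∣ p ℚ.- r ∣ ℚ.< δ → ℚ.∣ r ℚ.- t ∣ ℚ.< δ →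
           0ℚ ℚ.+ e ℚ.≤ u → ℚ.∣ p ℚ.- t ∣ ℚ.+ δ ℚ.≤ u
    step p r t {δ} {u} 3δ≡e p≈r r≈t e≤u = begin
      ℚ.∣ p ℚ.- t ∣ ℚ.+ δ    ≤⟨ ℚ.+-monoˡ-≤ δ (ℚ.<⇒≤ (near-trans p r t p≈r r≈t)) ⟩
      δ ℚ.+ δ ℚ.+ δ          ≡⟨ trans 3δ≡e (sym (ℚ.+-identityˡ e)) ⟩
      0ℚ ℚ.+ e               ≤⟨ e≤u ⟩
      u                      ∎

-- Application to the weak projection.

monotone-from-steps : ∀ (s : ℕ → ℝ) → (∀ k → s k ≤ s (suc k)) →
                      ∀ {k l} → k ℕ.≤ l → s k ≤ s l
monotone-from-steps s step k≤l = go (ℕ.≤⇒≤′ k≤l)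
  where
  go : ∀ {k l} → k ℕ.≤′ l → s k ≤ s l
  go {k} ℕ.≤′-refl = ≤-refl {s k}
  go {k} (ℕ.≤′-step {l} k≤′l) = ≤-trans {s k} {s l} {s (suc l)} (go k≤′l) (step l)

mainTheorem2 : ExcludedMiddle 0ℓ →
    (M : ℝ) (1≤M : 1ℝ ≤ M) (a : ℕ → ℝ≥0) →
    𝐀.Converges M 1≤M (𝐀.weakProjection M 1≤M a)
mainTheorem2 em M 1≤M a =
  mkCarrier limit A≤limit limit≤B ,
  λ U (V , V-open , U⇔V) l∈U →
    -- An open set of the subspace is the trace of some `V` open in the reals, so a ball around the
    -- limit inside `V` is enough.
    let (ε , 0<ε , ball⊆V) = V-open limit (Equivalence.to (U⇔V _) l∈U)
    in map (λ k near → Equivalence.from (U⇔V (t k)) (ball⊆V (s k) near)) (converges ε 0<ε)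
  where
  open 𝐀 M 1≤M
  t : ℕ → Carrier
  t = weakProjection a
  s : ℕ → ℝ
  s k = value (t k)
  S : ℕ → ℝ
  S k = real (sumOfFirst k a)
  open MonotoneConvergence em s 0ℝ M
    -- Position `k` truncates a sum of `k + 1` terms, so the step to the next position adds
    -- `a (suc k)`, which is nonnegative.
    (monotone-from-steps s λ k → min-monoʳ-≤ M {S (suc k)} {S (suc (suc k))}
      (x≤x+y (S (suc k)) (real (a (suc k))) (0≤real (a (suc k)))))
    (λ k → 0≤value (t k)) (λ k → value≤M (t k))
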